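{- For every uniformity $r\ge 4$, for all sufficiently large $c$ and $t$, \[ R^r_c(BK_t,BK_t,\dots,BK_t) > t^{\,1+\left(\frac{r-3}{r-2}\right)^{r-3}-\left(\frac{r-3}{r-2}\right)^{r-2}}. \]
   Context: For a graph $G=(V,E)$ and an integer $r\ge 2$, $BG$ is the set of $r$-uniform hypergraphs $\mathcal{H}'$ for which there exist an injection $\phi: V\to V(\mathcal{H}')$ and a bijection $\psi: E\to E(\mathcal{H}')$ such that $\{\phi(u),\phi(v)\}\subseteq \psi(uv)$ for every edge $uv\in E$. $K_t$ is the complete graph on $t$ vertices. $R^r_c(BK_t,\dots,BK_t)$ (with $c$ arguments) is the least $N$ such that every coloring of the hyperedges of the complete $r$-uniform hypergraph on $N$ vertices with $c$ colors contains a monochromatic subhypergraph isomorphic to a member of $BK_t$. -}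

module Defs where

open import Data.Nat using (ℕ; _+_; _*_; _∸_; _^_; _<_; _≥_)
open import Data.Fin using (Fin) renaming (_<_ to _<ᶠ_)
open import Data.Fin.Subset using (Subset; _∈_; ∣_∣)
open import Data.Product using (Σ; ∃; _×_; _,_; proj₁)
open import Relation.Binary.PropositionalEquality using (_≡_)
open import Function.Definitions using (Injective)

Edge : ℕ → Set
Edge t = Σ (Fin t × Fin t) (λ p → proj₁ p <ᶠ Data.Product.proj₂ p)

-- A c-colouring of the hyperedges of the complete r-uniform hypergraph on
-- vertex set Fin N.  Colours are assigned to all subsets; only the values
-- on r-element subsets (the hyperedges) are ever inspected.
Colouring : ℕ → ℕ → Set
Colouring N c = Subset N → Fin c

-- χ contains a monochromatic subhypergraph of K_N^(r) belonging to BK_t: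
-- an injection φ : V(K_t) → Fin N and an injective map ψ from the edges of
-- K_t to r-element subsets of Fin N (a bijection onto its image, which is
-- the edge set of the subhypergraph) with {φ u, φ v} ⊆ ψ(uv), all ψ(uv)
-- receiving the same colour k.
HasMonoBK : (r t N c : ℕ) → Colouring N c → Set
HasMonoBK r t N c χ =
  Σ (Fin c) λ k →
  Σ (Fin t → Fin N) λ φ →
  Σ (Edge t → Subset N) λ ψ →
    Injective _≡_ _≡_ φ ×
    Injective _≡_ _≡_ ψ ×
    ((e : Edge t) →
        ∣ ψ e ∣ ≡ r ×
        φ (proj₁ (proj₁ e)) ∈ ψ e ×
        φ (Data.Product.proj₂ (proj₁ e)) ∈ ψ e ×
        χ (ψ e) ≡ k)

Arrows : (r c t N : ℕ) → Set
Arrows r c t N = (χ : Colouring N c) → HasMonoBK r t N c χ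

-- "R^r_c(BK_t,...,BK_t) > X" where R is the least N with Arrows r c t N:
-- every N that arrows exceeds X.  Here X = t ^ (E / D) is a rational power,
-- encoded by raising both sides to the D-th power:  t ^ E < N ^ D.
RamseyExceedsPow : (r c t : ℕ) → (E D : ℕ) → Set
RamseyExceedsPow r c t E D = (N : ℕ) → Arrows r c t N → t ^ E < N ^ D

-- Exponent 1 + q^(r-3) - q^(r-2), q = (r-3)/(r-2), written as E r / D r.
-- D r = (r-2)^(r-2);  E r = D r + (r-3)^(r-3) * (r-2) - (r-3)^(r-2)
-- (the subtraction is nonnegative, so ∸ is exact).
D : ℕ → ℕ
D r = (r ∸ 2) ^ (r ∸ 2)

E : ℕ → ℕ
E r = D r + (r ∸ 3) ^ (r ∸ 3) * (r ∸ 2) ∸ (r ∸ 3) ^ (r ∸ 2)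

{-# OPTIONS --safe #-}
-- Identify a vertex v < q² with the point (v / q , v % q) of a q × q grid.  For a
-- slope k put f_k(x , y) = y + k x.  Two distinct points agree on f_k for at most one k,
-- so among m = r² + 1 slopes there is, for each r-set S, one for which f_k is injective
-- on S; colour S by such a k.  The core of a Berge-K_t of colour k is then mapped
-- injectively by f_k into m q values, so t ≤ m q.  Thus R > q² whenever m q < t, i.e. R
-- grows quadratically in t, while the exponent claimed is at most 3/2.
module Submission where

open import Defs
open import Data.Fin using (Fin; zero; suc; toℕ; fromℕ<; inject≤; combine)
import Data.Fin.Properties as Fin
open import Data.Fin.Subset using (Subset; _∈_; ∣_∣; inside; outside)
open import Data.Fin.Subset.Properties using (_∈?_)
open import Data.Nat using (ℕ; suc; _+_; _*_; _∸_; _^_; _/_; _%_; _≤_; _<_; _≥_; z≤n; s≤s; NonZero; >-nonZero; >-nonZero⁻¹)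
open import Data.Nat.DivMod using (m≡m%n+[m/n]*n; m%n<n; m/n*n≤m; m*n/n≡m; /-monoˡ-≤; m<n*o⇒m/o<n)
open import Data.Nat.Properties
open import Data.Nat.Solver using (module +-*-Solver)
open import Data.Product using (∃; ∃₂; _×_; _,_; proj₁; proj₂)
open import Data.Vec using (_∷_; here; there)
open import Function using (_∘_)
open import Function.Definitions using (Injective)
open import Relation.Binary.Definitions using (tri<; tri≈; tri>)
open import Relation.Binary.PropositionalEquality using (_≡_; _≢_; refl; sym; trans; cong; cong₂; subst; module ≡-Reasoning)
open import Relation.Nullary using (¬_; Dec; yes; no; contradiction; ¬?; _×-dec_)

-- Colourings from separating families of functions.

index : ∀ {N} {x : Fin N} {S : Subset N} → x ∈ S → Fin ∣ S ∣
index here                        = zero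
index {S = inside  ∷ _} (there p) = suc (index p)
index {S = outside ∷ _} (there p) = index p

index-injective : ∀ {N} {x y : Fin N} {S : Subset N} (p : x ∈ S) (q : y ∈ S) →
                  index p ≡ index q → x ≡ y
index-injective here here _ = refl
index-injective {S = inside  ∷ _} (there p) (there q) eq =
  cong suc (index-injective p q (Fin.suc-injective eq))
index-injective {S = outside ∷ _} (there p) (there q) eq =
  cong suc (index-injective p q eq)

module SeparatingFamily
  {m N : ℕ} (f : Fin m → Fin N → ℕ)
  (separates : ∀ {k l x y} → k ≢ l → f k x ≡ f k y → f l x ≡ f l y → x ≡ y)
  where

  Collides : Subset N → Fin m → Set
  Collides S k = ∃₂ λ x y → x ∈ S × y ∈ S × f k x ≡ f k y × x ≢ y

  collides? : ∀ S k → Dec (Collides S k)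
  collides? S k = Fin.any? λ x → Fin.any? λ y →
    (x ∈? S) ×-dec (y ∈? S) ×-dec (f k x ≟ f k y) ×-dec ¬? (x Fin.≟ y)

  collidingPair : ∀ {S k} → Collides S k → Fin (∣ S ∣ * ∣ S ∣)
  collidingPair (_ , _ , x∈S , y∈S , _) = combine (index x∈S) (index y∈S)

  -- If two different indices had the same colliding pair, both functions would agree on two
  -- distinct points, which `separates` forbids.
  collidingPair-injective : ∀ {S k l} (c : Collides S k) (d : Collides S l) →
                            collidingPair c ≡ collidingPair d → k ≡ l
  collidingPair-injective {k = k} {l} (_ , _ , x∈S , y∈S , fx≡fy , x≢y) (_ , _ , x′∈S , y′∈S , fx′≡fy′ , _) eq
    with i≡i′ , j≡j′ ← Fin.combine-injective (index x∈S) (index y∈S) (index x′∈S) (index y′∈S) eq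
    with refl ← index-injective x∈S x′∈S i≡i′
    with refl ← index-injective y∈S y′∈S j≡j′
    with k Fin.≟ l
  ... | yes k≡l = k≡l
  ... | no  k≢l = contradiction (separates k≢l fx≡fy fx′≡fy′) x≢y

  -- Pigeonhole: `m` indices cannot be sent injectively to fewer than `m` ordered pairs of elements
  -- of `S`.
  ¬all-collide : ∀ S → ∣ S ∣ * ∣ S ∣ < m → ¬ (∀ k → Collides S k)
  ¬all-collide S ∣S∣²<m c = Fin.<⇒notInjective ∣S∣²<m
    λ {k} {l} → collidingPair-injective (c k) (c l)

  injectiveColour : ∀ S → ∣ S ∣ * ∣ S ∣ < m → ∃ λ k → ¬ Collides S k
  injectiveColour S ∣S∣²<m =
    Fin.¬∀⟶∃¬ m (Collides S) (collides? S) (¬all-collide S ∣S∣²<m)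

  -- A colour is due for every subset, but the pigeonhole serves only those with
  -- `∣ S ∣ * ∣ S ∣ < m`; `default` covers the others.
  colouring : Fin m → Colouring N m
  colouring default S with ∣ S ∣ * ∣ S ∣ <? m
  ... | yes ∣S∣²<m = proj₁ (injectiveColour S ∣S∣²<m)
  ... | no  _      = default

  colouring-injectiveOn : ∀ {default S x y} → ∣ S ∣ * ∣ S ∣ < m → x ∈ S → y ∈ S →
    f (colouring default S) x ≡ f (colouring default S) y → x ≡ y
  colouring-injectiveOn {S = S} {x} {y} small x∈S y∈S eq with ∣ S ∣ * ∣ S ∣ <? m
  ... | no  ¬small = contradiction small ¬small
  ... | yes ∣S∣²<m with x Fin.≟ y
  ...   | yes x≡y = x≡y
  ...   | no  x≢y = contradiction (x , y , x∈S , y∈S , eq , x≢y)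
                                  (proj₂ (injectiveColour S ∣S∣²<m))

  -- Any two core vertices share a hyperedge, and all these hyperedges have one colour, so a single
  -- function of the family separates the whole core.
  arrows⇒≤ : ∀ {r c t B} → r * r < m → m ≤ c → 2 ≤ t → (∀ k x → f k x < B) →
             Arrows r c t N → t ≤ B
  arrows⇒≤ {r} {c} {t@(suc (suc _))} {B} r²<m m≤c (s≤s (s≤s z≤n)) f<B arrows = core (arrows χ)
    where
    χₘ : Colouring N m
    χₘ = colouring (fromℕ< (≤-trans (s≤s z≤n) r²<m))

    χ : Colouring N c
    χ S = inject≤ (χₘ S) m≤c

    core : HasMonoBK r t N c χ → t ≤ B
    core (k , φ , ψ , φ-inj , _ , ψ-ok) = Fin.injective⇒≤ {f = g} g-inj
      where
      -- The given `k` lies in `Fin c`; the index in `Fin m` is read off one edge, which exists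
      -- because `2 ≤ t`.
      e₀ : Edge t
      e₀ = (zero , suc zero) , s≤s z≤n

      k₀ : Fin m
      k₀ = χₘ (ψ e₀)

      mono : ∀ e → χₘ (ψ e) ≡ k₀
      mono e = Fin.inject≤-injective m≤c m≤c _ _
        (trans (proj₂ (proj₂ (proj₂ (ψ-ok e)))) (sym (proj₂ (proj₂ (proj₂ (ψ-ok e₀))))))

      g : Fin t → Fin B
      g u = fromℕ< (f<B k₀ (φ u))

      separated : ∀ (e : Edge t) → f k₀ (φ (proj₁ (proj₁ e))) ≡ f k₀ (φ (proj₂ (proj₁ e))) →
                  proj₁ (proj₁ e) ≡ proj₂ (proj₁ e)
      separated e eq with size , u∈ψ , v∈ψ , _ ← ψ-ok e =
        φ-inj (colouring-injectiveOn (subst (λ s → s * s < m) (sym size) r²<m) u∈ψ v∈ψ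
          (subst (λ j → f j _ ≡ f j _) (sym (mono e)) eq))

      g-inj : Injective _≡_ _≡_ g
      g-inj {u} {v} gu≡gv
        with eq ← Fin.fromℕ<-injective _ _ (f<B k₀ (φ u)) (f<B k₀ (φ v)) gu≡gv
        with Fin.<-cmp u v
      ... | tri< u<v _ _ = separated ((u , v) , u<v) eq
      ... | tri≈ _ u≡v _ = u≡v
      ... | tri> _ _ v<u = sym (separated ((v , u) , v<u) (sym eq))

-- Lines in the grid.

-- The equation is `(l - k)(y - x) = 0` without subtraction; writing `l` as `suc k + d` leaves the
-- positive factor `suc d` to cancel.
crossing-slopes : ∀ {k l} x y → k < l → k * x + l * y ≡ k * y + l * x → x ≡ y
crossing-slopes {k} {l} x y k<l eq = sym (*-cancelˡ-≡ y x (suc d)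
  (+-cancelˡ-≡ (k * x + k * y) _ _ (begin
    k * x + k * y + suc d * y  ≡⟨ lhs k x y d ⟩
    k * x + (suc k + d) * y    ≡⟨ cong (λ l → k * x + l * y) l≡ ⟩
    k * x + l * y              ≡⟨ eq ⟩
    k * y + l * x              ≡⟨ cong (λ l → k * y + l * x) (sym l≡) ⟩
    k * y + (suc k + d) * x    ≡⟨ rhs k x y d ⟩
    k * x + k * y + suc d * x  ∎)))
  where
  open ≡-Reasoning
  open +-*-Solver
  d : ℕ
  d = l ∸ suc k
  l≡ : suc k + d ≡ l
  l≡ = m+[n∸m]≡n k<l
  lhs : ∀ k x y d → k * x + k * y + suc d * y ≡ k * x + (suc k + d) * y
  lhs = solve 4 (λ k x y d → k :* x :+ k :* y :+ (con 1 :+ d) :* y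
                           := k :* x :+ (con 1 :+ k :+ d) :* y) refl
  rhs : ∀ k x y d → k * y + (suc k + d) * x ≡ k * x + k * y + suc d * x
  rhs = solve 4 (λ k x y d → k :* y :+ (con 1 :+ k :+ d) :* x
                           := k :* x :+ k :* y :+ (con 1 :+ d) :* x) refl

common-points-of-lines : ∀ {k l} a x b y → k ≢ l →
  a + k * x ≡ b + k * y → a + l * x ≡ b + l * y → a ≡ b × x ≡ y
common-points-of-lines {k} {l} a x b y k≢l eqₖ eqₗ = a≡b , x≡y
  where
  open +-*-Solver
  -- Adding the first equation to the reversed second puts `a + b` on both sides, so it cancels.
  crossed : ∀ k l → a + k * x ≡ b + k * y → a + l * x ≡ b + l * y →
            k * x + l * y ≡ k * y + l * x
  crossed k l eqₖ eqₗ = +-cancelˡ-≡ (a + b) _ _ (begin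
    a + b + (k * x + l * y)      ≡⟨ solve 4 (λ a b u v → a :+ b :+ (u :+ v) := (a :+ u) :+ (b :+ v)) refl a b (k * x) (l * y) ⟩
    (a + k * x) + (b + l * y)    ≡⟨ cong₂ _+_ eqₖ (sym eqₗ) ⟩
    (b + k * y) + (a + l * x)    ≡⟨ solve 4 (λ a b u v → (b :+ u) :+ (a :+ v) := a :+ b :+ (u :+ v)) refl a b (k * y) (l * x) ⟩
    a + b + (k * y + l * x)      ∎)
    where open ≡-Reasoning
  x≡y : x ≡ y
  x≡y with <-cmp k l
  ... | tri< k<l _ _ = crossing-slopes x y k<l (crossed k l eqₖ eqₗ)
  ... | tri≈ _ k≡l _ = contradiction k≡l k≢l
  ... | tri> _ _ l<k = crossing-slopes x y l<k (crossed l k eqₗ eqₖ)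
  a≡b : a ≡ b
  a≡b = +-cancelʳ-≡ (k * x) a b (trans eqₖ (cong (λ z → b + k * z) (sym x≡y)))

module Grid (q : ℕ) .{{_ : NonZero q}} where

  intercept : ℕ → ℕ → ℕ
  intercept k v = v % q + k * (v / q)

  intercept-separates : ∀ {k l v w} → k ≢ l →
    intercept k v ≡ intercept k w → intercept l v ≡ intercept l w → v ≡ w
  intercept-separates {v = v} {w} k≢l eqₖ eqₗ
    with eq% , eq/ ← common-points-of-lines (v % q) (v / q) (w % q) (w / q) k≢l eqₖ eqₗ = begin
      v                    ≡⟨ m≡m%n+[m/n]*n v q ⟩
      v % q + (v / q) * q  ≡⟨ cong₂ (λ a x → a + x * q) eq% eq/ ⟩
      w % q + (w / q) * q  ≡⟨ sym (m≡m%n+[m/n]*n w q) ⟩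
      w                    ∎
    where open ≡-Reasoning

  -- The remainder is below `q` and the quotient is at most `q`, so the value is below `(k + 1) q`.
  intercept< : ∀ {k m v} → k < m → v < q * q → intercept k v < m * q
  intercept< {k} {m} {v} k<m v<q² = begin-strict
    v % q + k * (v / q)  <⟨ +-mono-<-≤ (m%n<n v q) (*-monoʳ-≤ k (<⇒≤ (m<n*o⇒m/o<n v<q²))) ⟩
    suc k * q            ≤⟨ *-monoˡ-≤ q k<m ⟩
    m * q                ∎
    where open ≤-Reasoning

  arrows⇒≤ : ∀ {r c t N} → r * r < c → 2 ≤ t → N ≤ q * q → Arrows r c t N →
             t ≤ suc (r * r) * q
  arrows⇒≤ {r} r²<c 2≤t N≤q² = Separated.arrows⇒≤ ≤-refl r²<c 2≤t
    λ k x → intercept< (Fin.toℕ<n k) (<-≤-trans (Fin.toℕ<n x) N≤q²)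
    where
    module Separated = SeparatingFamily {suc (r * r)} (λ k x → intercept (toℕ k) (toℕ x))
      (λ k≢l eqₖ eqₗ → Fin.toℕ-injective
        (intercept-separates (k≢l ∘ Fin.toℕ-injective) eqₖ eqₗ))

-- Comparison of the powers.

^-cancelʳ-< : ∀ n {a b} → a ^ n < b ^ n → a < b
^-cancelʳ-< n {a} {b} aⁿ<bⁿ with a <? b
... | yes a<b = a<b
... | no  a≮b = contradiction (^-monoˡ-≤ n (≮⇒≥ a≮b)) (<⇒≱ aⁿ<bⁿ)

-- The subtraction telescopes to `E = d + p`, and `2 * p ≤ d` because `d` is `s + 2` times a power
-- that dominates `p`. Hence the exponent is at most 3/2.
2E≤3D : ∀ s → E (3 + suc s) * 2 ≤ 3 * D (3 + suc s)
2E≤3D s = begin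
  (d + p * suc (suc s) ∸ suc s * p) * 2  ≡⟨ cong (λ z → (d + z ∸ suc s * p) * 2) (*-comm p _) ⟩
  (d + (p + suc s * p) ∸ suc s * p) * 2  ≡⟨ cong (λ z → (z ∸ suc s * p) * 2) (sym (+-assoc d p _)) ⟩
  (d + p + suc s * p ∸ suc s * p) * 2    ≡⟨ cong (_* 2) (m+n∸n≡m (d + p) (suc s * p)) ⟩
  (d + p) * 2                            ≡⟨ solve 2 (λ d p → (d :+ p) :* con 2 := con 2 :* d :+ con 2 :* p) refl d p ⟩
  2 * d + 2 * p                          ≤⟨ +-monoʳ-≤ (2 * d) (*-mono-≤ {2} {suc (suc s)} (s≤s (s≤s z≤n)) (^-monoˡ-≤ (suc s) (n≤1+n (suc s)))) ⟩
  2 * d + d                              ≡⟨ solve 1 (λ d → con 2 :* d :+ d := con 3 :* d) refl d ⟩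
  3 * d                                  ∎
  where
  open ≤-Reasoning
  open +-*-Solver
  d p : ℕ
  d = suc (suc s) ^ suc (suc s)
  p = suc s ^ suc s

pow<-from-cube<square : ∀ {t N e d} .{{_ : NonZero t}} .{{_ : NonZero d}} →
  e * 2 ≤ 3 * d → t ^ 3 < N ^ 2 → t ^ e < N ^ d
pow<-from-cube<square {t} {N} {e} {d} 2e≤3d t³<N² = ^-cancelʳ-< 2 (begin-strict
  (t ^ e) ^ 2  ≡⟨ ^-*-assoc t e 2 ⟩
  t ^ (e * 2)  ≤⟨ ^-monoʳ-≤ t 2e≤3d ⟩
  t ^ (3 * d)  ≡⟨ sym (^-*-assoc t 3 d) ⟩
  (t ^ 3) ^ d  <⟨ ^-monoˡ-< d t³<N² ⟩
  (N ^ 2) ^ d  ≡⟨ ^-*-assoc N 2 d ⟩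
  N ^ (2 * d)  ≡⟨ cong (N ^_) (*-comm 2 d) ⟩
  N ^ (d * 2)  ≡⟨ sym (^-*-assoc N d 2) ⟩
  (N ^ d) ^ 2  ∎)
  where open ≤-Reasoning

-- Here `t < 2nq`, so its cube is below `(2n)³ q³`, and the constant is absorbed by one more factor
-- `q`.
cube<fourth-power : ∀ {t n q} .{{_ : NonZero q}} → t < n * suc q → (n * 2) ^ 3 ≤ q →
  t ^ 3 < (q * q) ^ 2
cube<fourth-power {t} {n} {q} t<n[1+q] [2n]³≤q = begin-strict
  t ^ 3                <⟨ ^-monoˡ-< 3 (<-≤-trans t<n[1+q] (*-monoʳ-≤ n 1+q≤2q)) ⟩
  (n * (2 * q)) ^ 3    ≡⟨ solve 2 (λ n q → (n :* (con 2 :* q)) :^ 3 := (n :* con 2) :^ 3 :* q :^ 3) refl n q ⟩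
  (n * 2) ^ 3 * q ^ 3  ≤⟨ *-monoˡ-≤ (q ^ 3) [2n]³≤q ⟩
  q * q ^ 3            ≡⟨ solve 1 (λ q → q :* q :^ 3 := (q :* q) :^ 2) refl q ⟩
  (q * q) ^ 2          ∎
  where
  open ≤-Reasoning
  open +-*-Solver
  1+q≤2q : suc q ≤ 2 * q
  1+q≤2q = +-mono-≤ (>-nonZero⁻¹ q) (m≤m+n q 0)

module Threshold (n : ℕ) .{{_ : NonZero n}} where

  -- Chosen so that the grid side `t / n` is at least `(2n)³`.
  t₀ : ℕ
  t₀ = (n * 2) ^ 3 * n

  module _ {t : ℕ} (t₀≤t : t₀ ≤ t) where

    t<n[1+t/n] : t < n * suc (t / n)
    t<n[1+t/n] = begin-strict
      t                    ≡⟨ m≡m%n+[m/n]*n t n ⟩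
      t % n + (t / n) * n  <⟨ +-monoˡ-< ((t / n) * n) (m%n<n t n) ⟩
      suc (t / n) * n      ≡⟨ *-comm (suc (t / n)) n ⟩
      n * suc (t / n)      ∎
      where open ≤-Reasoning

    [2n]³≤t/n : (n * 2) ^ 3 ≤ t / n
    [2n]³≤t/n = subst (_≤ t / n) (m*n/n≡m ((n * 2) ^ 3) n) (/-monoˡ-≤ n t₀≤t)

    2≤t/n : 2 ≤ t / n
    -- Uses `2 ≤ 2 * 4`, which is `2 ^ 3`, the case `n = 1` of the cube.
    2≤t/n = ≤-trans (≤-trans (m≤m*n 2 4) (^-monoˡ-≤ 3 (*-monoˡ-≤ 2 (>-nonZero⁻¹ n)))) [2n]³≤t/n

arrows⇒cube<square : ∀ {r c t N} → r * r < c → Threshold.t₀ (2 + r * r) ≤ t →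
                     Arrows r c t N → t ^ 3 < N ^ 2
arrows⇒cube<square {r} {c} {t} {N} r²<c t₀≤t arrows =
  <-≤-trans (cube<fourth-power {n = n} (t<n[1+t/n] t₀≤t) ([2n]³≤t/n t₀≤t)) (^-monoˡ-≤ 2 (<⇒≤ q²<N))
  where
  -- `n` is one more than the number `r² + 1` of slopes, so `n * q ≤ t` strictly contradicts the
  -- bound `t ≤ (r² + 1) q` that would follow from `N ≤ q * q`.
  n q : ℕ
  n = 2 + r * r
  q = t / n
  open Threshold n
  2≤q : 2 ≤ q
  2≤q = 2≤t/n t₀≤t
  instance
    q≢0 : NonZero q
    q≢0 = >-nonZero (<⇒≤ 2≤q)
  n*q≤t : n * q ≤ t
  n*q≤t = subst (_≤ t) (*-comm q n) (m/n*n≤m t n)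
  2≤t : 2 ≤ t
  2≤t = ≤-trans 2≤q (≤-trans (m≤n*m q n) n*q≤t)
  q²<N : q * q < N
  q²<N = ≰⇒> λ N≤q² → <⇒≱ (<-≤-trans (*-monoˡ-< q (n<1+n (suc (r * r)))) n*q≤t)
    (Grid.arrows⇒≤ q r²<c 2≤t N≤q² arrows)

theorem2p17 : (r : ℕ) → r ≥ 4 →
    ∃ λ c₀ → ∃ λ t₀ → (c t : ℕ) → c ≥ c₀ → t ≥ t₀ →
    RamseyExceedsPow r c t (E r) (D r)
theorem2p17 r@(suc (suc (suc (suc s)))) (s≤s (s≤s (s≤s (s≤s z≤n)))) = suc (r * r) , t₀ , λ c t c≥c₀ t≥t₀ N arrows →
  pow<-from-cube<square {e = E r} {D r} {{>-nonZero (≤-trans (s≤s z≤n) t≥t₀)}} {{m^n≢0 (2 + s) (2 + s)}}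
    (2E≤3D s) (arrows⇒cube<square c≥c₀ t≥t₀ arrows)
  where open Threshold (2 + r * r)
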